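{- Let $P\subseteq\{3,4,\ldots,\omega\}$ be infinite. Then there is $A\in\mathcal{F}_P$ which has infinite Ramsey degree in $\mathcal{F}_P$.
   Context: Trees are finite acyclic connected graphs; $ab$ denotes the path from $a$ to $b$ (a single vertex if $a=b$). $\mathcal{L}_P$ consists of a 4-ary symbol $D$ and unary symbols $K_p$, $p\in P$ ($\omega$ larger than every natural number). $\mathcal{F}_P$ is the class of finite $\mathcal{L}_P$-structures whose universe is the vertex set of a finite tree with no vertex of degree 2, with $D(a,b,c,d)$ iff paths $ab,cd$ share no vertex, and each vertex $a$ satisfying $K_p(a)$ for exactly one $p\in P$, with the degree of $a$ at most $p$. An embedding is an injective map $f$ with $R(\bar a)\iff R(f(\bar a))$ for all relation symbols $R$; $A\le B$ means $A$ embeds into $B$; $\binom{B}{A}$ is the set of embeddings of $A$ into $B$. For a class $\mathcal{G}$, $A\in\mathcal{G}$ has Ramsey degree $\ge t$ if there is $B\in\mathcal{G}$ with $A\le B$ such that for every $C\in\mathcal{G}$ with $B\le C$ there is a coloring $c_0\colon\binom{C}{A}\to\{1,\ldots,t\}$ such that for every $g\in\binom{C}{B}$ the set $\{c_0(g\circ f): f\in\binom{B}{A}\}$ has at least $t$ elements. $A$ has infinite Ramsey degree if it has Ramsey degree $\ge t$ for every $t$. -}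

module Defs where

open import Data.Nat using (ℕ; _≤_; _+_)
open import Data.Fin using (Fin)
open import Data.Bool using (Bool; true; false; if_then_else_)
open import Data.List using (List; []; _∷_; length; map; allFin)
open import Data.Nat.ListAction using (sum)
open import Data.List.Membership.Propositional using (_∈_)
open import Data.List.Relation.Unary.Unique.Propositional using (Unique)
open import Data.Product using (Σ; ∃; _×_; _,_)
open import Data.Unit using (⊤)
open import Data.Empty using (⊥)
open import Relation.Nullary using (¬_)
open import Relation.Binary.PropositionalEquality using (_≡_; _≢_)

data ℕω : Set where
  fin : ℕ → ℕω
  ω   : ℕω

_≤ω_ : ℕ → ℕω → Set
m ≤ω fin p = m ≤ p
m ≤ω ω     = ⊤

Graph : ℕ → Set
Graph n = Fin n → Fin n → Bool

IsSimple : ∀ {n} → Graph n → Set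
IsSimple {n} E = (∀ a b → E a b ≡ E b a) × (∀ a → E a a ≡ false)

data Walk {n : ℕ} (E : Graph n) : Fin n → Fin n → List (Fin n) → Set where
  here : ∀ a → Walk E a a (a ∷ [])
  step : ∀ {a b c vs} → E a b ≡ true → Walk E b c vs → Walk E a c (a ∷ vs)

Path : ∀ {n} → Graph n → Fin n → Fin n → List (Fin n) → Set
Path E a b vs = Walk E a b vs × Unique vs

Connected : ∀ {n} → Graph n → Set
Connected E = ∀ a b → ∃ λ vs → Walk E a b vs

HasCycle : ∀ {n} → Graph n → Set
HasCycle {n} E = Σ (Fin n) λ a → Σ (Fin n) λ b → Σ (List (Fin n)) λ vs →
  Path E a b vs × (3 ≤ length vs) × (E b a ≡ true)

Acyclic : ∀ {n} → Graph n → Set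
Acyclic E = ¬ HasCycle E

IsTree : ∀ {n} → Graph n → Set
IsTree {n} E = (1 ≤ n) × IsSimple E × Connected E × Acyclic E

degree : ∀ {n} → Graph n → Fin n → ℕ
degree {n} E a = sum (map (λ b → if E a b then 1 else 0) (allFin n))

-- L_P-structures: universe Fin n, 4-ary relation D, and the unary K_p
-- encoded by the unique label p of each vertex.

record Str : Set where
  field
    size : ℕ
    D    : Fin size → Fin size → Fin size → Fin size → Bool
    K    : Fin size → ℕω   -- K_p(a) iff K a ≡ p
open Str public

PathsDisjoint : ∀ {n} → Graph n → Fin n → Fin n → Fin n → Fin n → Set
PathsDisjoint {n} E a b c d = ∀ vs ws → Path E a b vs → Path E c d ws →
  ∀ v → v ∈ vs → v ∈ ws → ⊥

IsFPTree : (ℕω → Set) → (A : Str) → Graph (size A) → Set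
IsFPTree P A E =
  IsTree E ×
  (∀ a → degree E a ≢ 2) ×
  (∀ a b c d → (D A a b c d ≡ true → PathsDisjoint E a b c d)
             × (PathsDisjoint E a b c d → D A a b c d ≡ true)) ×
  (∀ a → P (K A a)) ×
  (∀ a → degree E a ≤ω K A a)

𝓕 : (ℕω → Set) → Str → Set
𝓕 P A = Σ (Graph (size A)) λ E → IsFPTree P A E

IsEmbedding : (A B : Str) → (Fin (size A) → Fin (size B)) → Set
IsEmbedding A B f =
  (∀ x y → f x ≡ f y → x ≡ y) ×
  (∀ a b c d → D A a b c d ≡ D B (f a) (f b) (f c) (f d)) ×
  (∀ a → K A a ≡ K B (f a))

Emb : Str → Str → Set
Emb A B = Σ (Fin (size A) → Fin (size B)) (IsEmbedding A B)

_≤S_ : Str → Str → Set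
A ≤S B = Emb A B

compE : ∀ A B C → Emb B C → Emb A B → Emb A C
compE A B C (g , gi , gD , gK) (f , fi , fD , fK) =
  (λ x → g (f x)) ,
  (λ x y e → fi x y (gi (f x) (f y) e)) ,
  (λ a b c d → trans' (fD a b c d) (gD (f a) (f b) (f c) (f d))) ,
  (λ a → trans' (fK a) (gK (f a)))
  where
  trans' : ∀ {X : Set} {x y z : X} → x ≡ y → y ≡ z → x ≡ z
  trans' _≡_.refl q = q

-- the set {c0 (g ∘ f) : f ∈ binom B A} has at least t elements,
-- i.e. (as it is a subset of Fin t) it is all of Fin t
RamseyDegreeAtLeast : (Str → Set) → Str → ℕ → Set
RamseyDegreeAtLeast G A t =
  Σ Str λ B → G B × A ≤S B ×
    (∀ C → G C → B ≤S C →
      Σ (Emb A C → Fin t) λ c0 →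
        ∀ (g : Emb B C) (i : Fin t) → ∃ λ (f : Emb A B) → c0 (compE A B C g f) ≡ i)

InfiniteRamseyDegree : (Str → Set) → Str → Set
InfiniteRamseyDegree G A = ∀ (t : ℕ) → 1 ≤ t → RamseyDegreeAtLeast G A t

{-# OPTIONS --safe #-}

-- Take for A a single edge.  An embedding of A into C is a pair of distinct
-- vertices x, y with the right labels; fix a root r of C and colour the pair
-- by the label of the median of r, x, y.  If a vertex v of B has three leaves
-- attached, then in any copy of B inside C at most one of these leaves lies on
-- the same side of v as r, so v is the median of r and the two others.  Since P
-- is infinite, B can have such vertices v with arbitrarily many labels.
module Submission where

open import Defs
open import Data.Bool using (true; false; if_then_else_)
open import Data.Empty using (⊥; ⊥-elim)
open import Data.Fin using (Fin; zero; suc; toℕ; fromℕ<; _↑ˡ_)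
open import Data.Fin.Properties using (_≟_; any?; toℕ-injective; toℕ<n; suc-injective; ↑ˡ-injective)
open import Data.List using (List; []; _∷_; length; tabulate)
open import Data.List.Membership.Propositional using (_∈_; _∉_)
open import Data.List.Properties using (map-tabulate)
open import Data.List.Relation.Unary.All using ([]; _∷_)
open import Data.List.Relation.Unary.All.Properties using (¬Any⇒All¬; All¬⇒¬Any)
open import Data.List.Relation.Unary.AllPairs using ([]; _∷_)
open import Data.List.Relation.Unary.Any using (here; there)
open import Data.Nat using (ℕ; zero; suc; _+_; _≤_; _<_; z≤n; s≤s)
import Data.Nat.Properties as ℕ
open import Data.Nat.ListAction using (sum)
open import Data.Product using (Σ; ∃; ∃₂; _×_; _,_; proj₁; proj₂)
open import Data.Sum using (_⊎_; inj₁; inj₂)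
open import Function using (_∘_; const)
open import Relation.Binary.Definitions using (tri<; tri≈; tri>)
open import Relation.Binary.PropositionalEquality
  using (_≡_; _≢_; refl; sym; trans; cong; subst; ≢-sym)
open import Relation.Nullary using (¬_; Dec; yes; no; does; ¬?; contradiction; _×-dec_)
open import Relation.Nullary.Decidable using (map′; dec-true)

import Data.List.Membership.DecPropositional as DecMembership
open module FinMembership {n} = DecMembership (_≟_ {n}) using (_∈?_)

private variable
  n : ℕ

-- Walks avoiding a vertex

-- Being in the same component of `E` with `m` deleted. Without a vertex list, transitivity and
-- symmetry are immediate; in a tree the relation coincides with `D m m a b`, so embeddings respect
-- it.
data Reach {n} (E : Graph n) (m : Fin n) : Fin n → Fin n → Set where
  stop : ∀ {a} → a ≢ m → Reach E m a a
  go   : ∀ {a b c} → a ≢ m → E a b ≡ true → Reach E m b c → Reach E m a c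

Symmetric : Graph n → Set
Symmetric E = ∀ a b → E a b ≡ E b a

module _ {E : Graph n} where

  Reach-source≢ : ∀ {m a b} → Reach E m a b → a ≢ m
  Reach-source≢ (stop p)   = p
  Reach-source≢ (go p _ _) = p

  Reach-target≢ : ∀ {m a b} → Reach E m a b → b ≢ m
  Reach-target≢ (stop p)   = p
  Reach-target≢ (go _ _ r) = Reach-target≢ r

  Reach-trans : ∀ {m a b c} → Reach E m a b → Reach E m b c → Reach E m a c
  Reach-trans (stop _)   s = s
  Reach-trans (go p e r) s = go p e (Reach-trans r s)

  Reach-sym : Symmetric E → ∀ {m a b} → Reach E m a b → Reach E m b a
  Reach-sym E-sym (stop p) = stop p
  Reach-sym E-sym (go p e r) =
    Reach-trans (Reach-sym E-sym r)
      (go (Reach-source≢ r) (trans (E-sym _ _) e) (stop p))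

  source∈ : ∀ {a b vs} → Walk E a b vs → a ∈ vs
  source∈ (here _)   = here refl
  source∈ (step _ _) = here refl

  target∈ : ∀ {a b vs} → Walk E a b vs → b ∈ vs
  target∈ (here _)   = here refl
  target∈ (step _ w) = there (target∈ w)

  walk-snoc : ∀ {a b c vs} → Walk E a b vs → E b c ≡ true →
    ∃ λ ws → Walk E a c ws
  walk-snoc (here a)   e′ = _ , step e′ (here _)
  walk-snoc (step e w) e′ = _ , step e (proj₂ (walk-snoc w e′))

  walk⇒reach : ∀ {m a b vs} → Walk E a b vs → m ∉ vs → Reach E m a b
  walk⇒reach (here a)   m∉ = stop λ { refl → m∉ (here refl) }
  walk⇒reach (step e w) m∉ =
    go (λ { refl → m∉ (here refl) }) e (walk⇒reach w (m∉ ∘ there))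

  reach⇒walk : ∀ {m a b} → Reach E m a b → ∃ λ vs → Walk E a b vs × m ∉ vs
  reach⇒walk (stop p) = _ , here _ , λ { (here q) → p (sym q) }
  reach⇒walk (go p e r) with reach⇒walk r
  ... | _ , w , m∉ = _ , step e w , λ { (here q) → p (sym q) ; (there q) → m∉ q }

  walk-suffix : ∀ {a b c vs} → Path E b c vs → a ∈ vs →
    ∃ λ ws → Path E a c ws × (∀ {v} → v ∈ ws → v ∈ vs)
  walk-suffix p@(here _ , _)   (here refl) = _ , p , λ q → q
  walk-suffix p@(step _ _ , _) (here refl) = _ , p , λ q → q
  walk-suffix (step _ w , _ ∷ u) (there a∈) with walk-suffix (w , u) a∈
  ... | _ , p , ⊆vs = _ , p , there ∘ ⊆vs

  walk⇒path : ∀ {a b vs} → Walk E a b vs →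
    ∃ λ ws → Path E a b ws × (∀ {v} → v ∈ ws → v ∈ vs)
  walk⇒path (here a) = _ , (here a , [] ∷ []) , λ q → q
  walk⇒path (step {a} e w) with walk⇒path w
  ... | ws , p@(w′ , u) , ⊆vs with a ∈? ws
  ...   | no a∉ = _ , (step e w′ , ¬Any⇒All¬ ws a∉ ∷ u) ,
                  λ { (here q) → here q ; (there q) → there (⊆vs q) }
  ...   | yes a∈ with walk-suffix p a∈
  ...     | _ , p′ , ⊆ws = _ , p′ , there ∘ ⊆vs ∘ ⊆ws

  closed-path-trivial : ∀ {a v vs} → Path E a a vs → v ∈ vs → v ≡ a
  closed-path-trivial (here _ , _)       (here q) = q
  closed-path-trivial (step _ w , a∉ ∷ _) _ = ⊥-elim (All¬⇒¬Any a∉ (target∈ w))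

  -- Stop the walk at whichever of `m` and `m′` it meets first.
  reach-first : ∀ {x m m′ vs} → m ≢ m′ → Walk E x m vs →
    Reach E m′ x m ⊎ Reach E m x m′
  reach-first m≢m′ (here _) = inj₁ (stop m≢m′)
  reach-first {x} {m} {m′} m≢m′ (step e w) with x ≟ m | x ≟ m′ | reach-first m≢m′ w
  ... | yes refl | _        | _      = inj₁ (stop m≢m′)
  ... | no _     | yes refl | _      = inj₂ (stop (≢-sym m≢m′))
  ... | no _     | no x≢m′  | inj₁ r = inj₁ (go x≢m′ e r)
  ... | no x≢m   | no _     | inj₂ r = inj₂ (go x≢m e r)

-- Trees

-- Acyclicity in the form stable under adding a leaf.
NoDetour : Graph n → Set
NoDetour E = ∀ {m c c′} → E m c ≡ true → E m c′ ≡ true → c ≢ c′ → ¬ Reach E m c c′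

-- On a cycle through `a`, the second and the last vertex are distinct neighbours of `a`, and the
-- rest of the cycle joins them without using `a`.
noDetour⇒acyclic : {E : Graph n} → Symmetric E → NoDetour E → Acyclic E
noDetour⇒acyclic E-sym nd (_ , _ , _ , (here _ , _) , s≤s () , _)
noDetour⇒acyclic E-sym nd (_ , _ , _ , (step _ (here _) , _) , s≤s (s≤s ()) , _)
noDetour⇒acyclic E-sym nd (a , b , _ , (step e w@(step _ w′) , a∉ ∷ (c∉ ∷ _)) , _ , e′) =
  nd e (trans (E-sym a b) e′)
    (λ { refl → All¬⇒¬Any c∉ (target∈ w′) })
    (walk⇒reach w (All¬⇒¬Any a∉))

acyclic⇒noDetour : {E : Graph n} → Symmetric E → Acyclic E → NoDetour E
acyclic⇒noDetour E-sym acyc {m} {c} {c′} e e′ c≢c′ r with reach⇒walk r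
... | _ , w , m∉ with walk⇒path w
...   | _ , (here _ , _) , _ = c≢c′ refl
...   | ws , (w′@(step _ w″) , u) , ⊆vs =
  acyc (m , c′ , m ∷ ws , (step e w′ , ¬Any⇒All¬ ws (m∉ ∘ ⊆vs) ∷ u) ,
        s≤s (s≤s (nonempty w″)) , trans (E-sym c′ m) e′)
  where
  nonempty : ∀ {E : Graph n} {a b vs} → Walk E a b vs → 1 ≤ length vs
  nonempty (here _)   = s≤s z≤n
  nonempty (step _ _) = s≤s z≤n

-- Induction along the path, prolonging the walk that avoids `m` backwards by each edge passed. If
-- the next vertex is `m` itself, the path leaves `m` for good by a second neighbour, which is then
-- joined to the first one around `m`: a detour.
path-avoids : {E : Graph n} → Symmetric E → NoDetour E →
  ∀ {m x y vs} → Reach E m x y → Path E x y vs → m ∉ vs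
path-avoids E-sym nd r (here _ , _)   (here refl) = Reach-source≢ r refl
path-avoids E-sym nd r (step _ _ , _) (here refl) = Reach-source≢ r refl
path-avoids {E = E} E-sym nd {m} {x} r (step {b = b} e w , x∉ ∷ u) (there m∈) with b ≟ m
... | no b≢m =
  path-avoids E-sym nd (go b≢m (trans (E-sym b x) e) r) (w , u) m∈
... | yes refl with w | u
...   | here _ | _ = Reach-target≢ r refl
...   | step e′ w′ | m∉ ∷ _ =
  nd (trans (E-sym m x) e) e′
    (λ { refl → All¬⇒¬Any x∉ (there (source∈ w′)) })
    (Reach-trans r (Reach-sym E-sym (walk⇒reach w′ (All¬⇒¬Any m∉))))

module Tree {E : Graph n} (E-tree : IsTree E) where

  E-sym : Symmetric E
  E-sym = proj₁ (proj₁ (proj₂ E-tree))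

  E-noDetour : NoDetour E
  E-noDetour = acyclic⇒noDetour E-sym (proj₂ (proj₂ (proj₂ E-tree)))

  walk : ∀ a b → ∃ λ vs → Walk E a b vs
  walk = proj₁ (proj₂ (proj₂ E-tree))

  path : ∀ a b → ∃ λ vs → Path E a b vs
  path a b with walk⇒path (proj₂ (walk a b))
  ... | vs , p , _ = vs , p

  path-unique : ∀ {a b v vs ws} → Path E a b vs → Path E a b ws → v ∈ vs → v ∈ ws
  path-unique {v = v} {ws = ws} p (w , u) v∈ with v ∈? ws
  ... | yes v∈ws = v∈ws
  ... | no v∉ws = ⊥-elim (path-avoids E-sym E-noDetour (walk⇒reach w v∉ws) p v∈)

  -- By `path-unique` it suffices to compare one chosen path for each pair. This decision supplies
  -- the Boolean `D` of `structure`.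
  pathsDisjoint? : ∀ a b c d → Dec (PathsDisjoint E a b c d)
  pathsDisjoint? a b c d = map′
    (λ none vs ws p q v v∈ v∈′ → none
      (v , path-unique p (proj₂ (path a b)) v∈ , path-unique q (proj₂ (path c d)) v∈′))
    (λ { disj (v , v∈ , v∈′) → disj _ _ (proj₂ (path a b)) (proj₂ (path c d)) v v∈ v∈′ })
    (¬? (any? λ v → (v ∈? proj₁ (path a b)) ×-dec (v ∈? proj₁ (path c d))))

  -- The only path from `m` to `m` is the single vertex, so disjointness from it says that `m` is
  -- off the path from `x` to `y`.
  reach⇒disjoint : ∀ {m x y} → Reach E m x y → PathsDisjoint E m m x y
  reach⇒disjoint r vs ws p q v v∈ v∈′ with closed-path-trivial p v∈
  ... | refl = path-avoids E-sym E-noDetour r q v∈′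

  disjoint⇒reach : ∀ {m x y} → PathsDisjoint E m m x y → Reach E m x y
  disjoint⇒reach {m} {x} {y} disj with path x y
  ... | ws , q = walk⇒reach (proj₁ q)
    (disj _ ws (here m , [] ∷ []) q m (here refl))

  -- The usual median of three vertices of a tree, as the vertex whose removal leaves no two of them
  -- connected. It may be one of the three: `Reach E m` never holds at `m`.
  record Median (r x y m : Fin n) : Set where
    constructor median
    field
      cut-xy : ¬ Reach E m x y
      cut-rx : ¬ Reach E m r x
      cut-ry : ¬ Reach E m r y

  -- If m ≢ m′, two of the three points reach the same one of m, m′ while
  -- avoiding the other one, which then fails to separate them.
  median-unique : ∀ {r x y m m′} → Median r x y m → Median r x y m′ → m ≡ m′
  median-unique {r} {x} {y} {m} {m′} (median xy rx ry) (median xy′ rx′ ry′) with m ≟ m′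
  ... | yes m≡m′ = m≡m′
  ... | no m≢m′ with side r | side x | side y
    where
    side : ∀ z → Reach E m′ z m ⊎ Reach E m z m′
    side z = reach-first m≢m′ (proj₂ (walk z m))
  ...   | inj₁ s | inj₁ t | _      = ⊥-elim (rx′ (Reach-trans s (Reach-sym E-sym t)))
  ...   | inj₁ s | inj₂ _ | inj₁ t = ⊥-elim (ry′ (Reach-trans s (Reach-sym E-sym t)))
  ...   | inj₁ _ | inj₂ s | inj₂ t = ⊥-elim (xy (Reach-trans s (Reach-sym E-sym t)))
  ...   | inj₂ s | inj₂ t | _      = ⊥-elim (rx (Reach-trans s (Reach-sym E-sym t)))
  ...   | inj₂ s | inj₁ _ | inj₂ t = ⊥-elim (ry (Reach-trans s (Reach-sym E-sym t)))
  ...   | inj₂ _ | inj₁ s | inj₁ t = ⊥-elim (xy′ (Reach-trans s (Reach-sym E-sym t)))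

  reach? : ∀ m x y → Dec (Reach E m x y)
  reach? m x y = map′ disjoint⇒reach reach⇒disjoint (pathsDisjoint? m m x y)

  median? : ∀ r x y m → Dec (Median r x y m)
  median? r x y m = map′
    (λ { (p , q , s) → median p q s }) (λ { (median p q s) → p , q , s })
    (¬? (reach? m x y) ×-dec ¬? (reach? m r x) ×-dec ¬? (reach? m r y))

  module _ {v : Fin n} {y : Fin 3 → Fin n}
           (apart : ∀ {j k} → j ≢ k → ¬ Reach E v (y j) (y k)) where

    -- The `y j` lie pairwise apart once `v` is removed, so `r` is connected to at most one of them;
    -- the other two serve.
    tripod-median : ∀ r → ∃₂ λ j k → j ≢ k × Median r (y j) (y k) v
    tripod-median r with reach? v r (y zero) | reach? v r (y (suc zero))
    ... | yes r₀ | _ =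
      suc zero , suc (suc zero) , (λ ()) , median (apart λ ()) (other λ ()) (other λ ())
      where
      other : ∀ {k} → zero ≢ k → ¬ Reach E v r (y k)
      other 0≢k s = apart 0≢k (Reach-trans (Reach-sym E-sym r₀) s)
    ... | no ¬r₀ | yes r₁ =
      zero , suc (suc zero) , (λ ()) ,
      median (apart λ ()) ¬r₀
        (λ s → apart {suc zero} {suc (suc zero)} (λ ())
          (Reach-trans (Reach-sym E-sym r₁) s))
    ... | no ¬r₀ | no ¬r₁ =
      zero , suc zero , (λ ()) , median (apart λ ()) ¬r₀ ¬r₁

-- Adding a leaf

-- The new leaf is `zero` and the old vertices are shifted by `suc`, so the latest vertices have the
-- smallest indices.
attach : Graph n → Fin n → Graph (suc n)
attach E u zero    zero    = false
attach E u zero    (suc b) = does (u ≟ b)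
attach E u (suc a) zero    = does (u ≟ a)
attach E u (suc a) (suc b) = E a b

does⇒ : {X : Set} (x? : Dec X) → does x? ≡ true → X
does⇒ (yes x) _ = x

degree-tabulate : (E : Graph n) (a : Fin n) →
  degree E a ≡ sum (tabulate (λ b → if E a b then 1 else 0))
degree-tabulate E a = cong sum (map-tabulate (λ b → b) (λ b → if E a b then 1 else 0))

sum-zero : ∀ n → sum (tabulate {n = n} (const 0)) ≡ 0
sum-zero zero    = refl
sum-zero (suc n) = sum-zero n

sum-indicator : (u : Fin n) → sum (tabulate (λ b → if does (u ≟ b) then 1 else 0)) ≡ 1
sum-indicator {suc n} zero    = cong suc (sum-zero n)
sum-indicator {suc n} (suc u) = sum-indicator u

degree-leaf : (E : Graph n) (u : Fin n) → degree (attach E u) zero ≡ 1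
degree-leaf E u = trans (degree-tabulate (attach E u) zero) (sum-indicator u)

degree-attach : (E : Graph n) (u a : Fin n) →
  degree (attach E u) (suc a) ≡ (if does (u ≟ a) then 1 else 0) + degree E a
degree-attach E u a = trans (degree-tabulate (attach E u) (suc a))
  (cong ((if does (u ≟ a) then 1 else 0) +_) (sym (degree-tabulate E a)))

module _ {E : Graph n} (u : Fin n) where

  attach-sym : Symmetric E → Symmetric (attach E u)
  attach-sym E-sym zero    zero    = refl
  attach-sym E-sym zero    (suc b) = refl
  attach-sym E-sym (suc a) zero    = refl
  attach-sym E-sym (suc a) (suc b) = E-sym a b

  lift-walk : ∀ {a b vs} → Walk E a b vs → ∃ λ ws → Walk (attach E u) (suc a) (suc b) ws
  lift-walk (here a)   = _ , here (suc a)
  lift-walk (step e w) = _ , step e (proj₂ (lift-walk w))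

  u-adjacent : does (u ≟ u) ≡ true
  u-adjacent = dec-true (u ≟ u) refl

  attach-connected : Connected E → Connected (attach E u)
  attach-connected conn zero    zero    = _ , here zero
  attach-connected conn zero    (suc b) =
    _ , step u-adjacent (proj₂ (lift-walk (proj₂ (conn u b))))
  attach-connected conn (suc a) zero    =
    walk-snoc (proj₂ (lift-walk (proj₂ (conn a u)))) u-adjacent
  attach-connected conn (suc a) (suc b) = lift-walk (proj₂ (conn a b))

  -- A walk between old vertices enters the leaf from `u` and must return to `u`; cutting out these
  -- excursions leaves a walk in `E`.
  reach-project : ∀ {m a b} → Reach (attach E u) (suc m) (suc a) (suc b) → Reach E m a b
  reach-project (stop p) = stop (p ∘ cong suc)
  reach-project (go {b = suc _} p e r) = go (p ∘ cong suc) e (reach-project r)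
  reach-project (go {b = zero} p e (go {b = suc c} q e′ r))
    with does⇒ (u ≟ _) e | does⇒ (u ≟ c) e′
  ... | refl | refl = reach-project r

  leaf-separated : ∀ {b} → ¬ Reach (attach E u) (suc u) zero (suc b)
  leaf-separated (go {b = suc c} _ e r) with does⇒ (u ≟ c) e
  ... | refl = Reach-source≢ r refl

  -- The leaf has `u` as its only neighbour, so it is not the vertex bypassed. If it is one of the
  -- two neighbours, the bypassed vertex is `u`, which cuts it off; otherwise the detour projects to
  -- `E`.
  attach-noDetour : Symmetric E → NoDetour E → NoDetour (attach E u)
  attach-noDetour E-sym nd {zero} {suc c} {suc c′} e e′ c≢c′ r
    with does⇒ (u ≟ c) e | does⇒ (u ≟ c′) e′
  ... | refl | refl = c≢c′ refl
  attach-noDetour E-sym nd {suc m} {zero} {zero} e e′ c≢c′ r = c≢c′ refl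
  attach-noDetour E-sym nd {suc m} {zero} {suc c′} e e′ c≢c′ r
    with does⇒ (u ≟ m) e
  ... | refl = leaf-separated r
  attach-noDetour E-sym nd {suc m} {suc c} {zero} e e′ c≢c′ r
    with does⇒ (u ≟ m) e′
  ... | refl = leaf-separated (Reach-sym (attach-sym E-sym) r)
  attach-noDetour E-sym nd {suc m} {suc c} {suc c′} e e′ c≢c′ r =
    nd e e′ (c≢c′ ∘ cong suc) (reach-project r)

  attach-tree : IsTree E → IsTree (attach E u)
  attach-tree E-tree@(_ , (E-sym , E-irr) , conn , _) =
    s≤s z≤n ,
    (attach-sym E-sym , λ { zero → refl ; (suc a) → E-irr a }) ,
    attach-connected conn ,
    noDetour⇒acyclic (attach-sym E-sym) (attach-noDetour E-sym (Tree.E-noDetour E-tree))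

single : Graph 1
single _ _ = false

single-tree : IsTree single
single-tree =
  s≤s z≤n , ((λ _ _ → refl) , λ _ → refl) ,
  (λ { zero zero → _ , here zero }) ,
  noDetour⇒acyclic (λ _ _ → refl) λ ()

-- Structures of trees

module _ {E : Graph n} (E-tree : IsTree E) (K : Fin n → ℕω) where

  structure : Str
  structure = record
    { size = n
    ; D    = λ a b c d → does (Tree.pathsDisjoint? E-tree a b c d)
    ; K    = K
    }

  structure-isFPTree : (P : ℕω → Set) → (∀ a → degree E a ≢ 2) → (∀ a → P (K a)) →
    (∀ a → degree E a ≤ω K a) → IsFPTree P structure E
  structure-isFPTree P deg≢2 PK deg≤K =
    E-tree , deg≢2 ,
    (λ a b c d → does⇒ (Tree.pathsDisjoint? E-tree a b c d) ,
                 dec-true (Tree.pathsDisjoint? E-tree a b c d)) ,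
    PK , deg≤K

module FPTree {P : ℕω → Set} {S : Str} {E : Graph (size S)} (S-tree : IsFPTree P S E) where

  open Tree (proj₁ S-tree) public

  private
    D⇔disjoint = proj₁ (proj₂ (proj₂ S-tree))

  -- With its converse this expresses separation by a vertex through `D` alone. Embeddings therefore
  -- transport separation, although an edge may be sent to a longer path.
  D≡true⇒reach : ∀ {m x y} → D S m m x y ≡ true → Reach E m x y
  D≡true⇒reach e = disjoint⇒reach (proj₁ (D⇔disjoint _ _ _ _) e)

  reach⇒D≡true : ∀ {m x y} → Reach E m x y → D S m m x y ≡ true
  reach⇒D≡true r = proj₂ (D⇔disjoint _ _ _ _) (reach⇒disjoint r)

  D-distinct : ∀ {a c} → a ≢ c → D S a a c c ≡ true
  D-distinct a≢c = reach⇒D≡true (stop (≢-sym a≢c))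

  D-common : ∀ {a b c d} → (a ≡ c ⊎ a ≡ d) ⊎ (b ≡ c ⊎ b ≡ d) → D S a b c d ≡ false
  D-common {a} {b} {c} {d} common with D S a b c d in eq
  ... | false = refl
  ... | true  = ⊥-elim (shared common)
    where
    disj : ∀ v → v ∈ proj₁ (path a b) → v ∈ proj₁ (path c d) → ⊥
    disj = proj₁ (D⇔disjoint a b c d) eq _ _ (proj₂ (path a b)) (proj₂ (path c d))
    src : ∀ x y → x ∈ proj₁ (path x y)
    src x y = source∈ (proj₁ (proj₂ (path x y)))
    tgt : ∀ x y → y ∈ proj₁ (path x y)
    tgt x y = target∈ (proj₁ (proj₂ (path x y)))
    shared : (a ≡ c ⊎ a ≡ d) ⊎ (b ≡ c ⊎ b ≡ d) → ⊥
    shared (inj₁ (inj₁ refl)) = disj a (src a b) (src c d)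
    shared (inj₁ (inj₂ refl)) = disj a (src a b) (tgt c d)
    shared (inj₂ (inj₁ refl)) = disj b (tgt a b) (src c d)
    shared (inj₂ (inj₂ refl)) = disj b (tgt a b) (tgt c d)

-- The single edge and its embeddings

pair : {X : Set} → X → X → Fin 2 → X
pair x y zero       = x
pair x y (suc zero) = y

-- Among two elements, `a` and `b` both differing from `c` and `d` forces `a ≡ b` and `c ≡ d`. Hence
-- `D` on two vertices is determined by equalities of its arguments.
coincidence : (a b c d : Fin 2) →
  (a ≡ b × c ≡ d × a ≢ c) ⊎ ((a ≡ c ⊎ a ≡ d) ⊎ (b ≡ c ⊎ b ≡ d))
coincidence a b c d with a ≟ c | a ≟ d | b ≟ c
... | yes p | _     | _     = inj₂ (inj₁ (inj₁ p))
... | no _  | yes p | _     = inj₂ (inj₁ (inj₂ p))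
... | no _  | no _  | yes p = inj₂ (inj₂ (inj₁ p))
... | no p  | no q  | no r  =
  inj₁ (≢-≢ p (≢-sym r) , ≢-≢ (≢-sym p) q , p)
  where
  ≢-≢ : {a b c : Fin 2} → a ≢ c → c ≢ b → a ≡ b
  ≢-≢ {zero}     {zero}     _ _ = refl
  ≢-≢ {suc zero} {suc zero} _ _ = refl
  ≢-≢ {zero}     {suc zero} {zero}     p q = contradiction refl p
  ≢-≢ {zero}     {suc zero} {suc zero} p q = contradiction refl q
  ≢-≢ {suc zero} {zero}     {zero}     p q = contradiction refl q
  ≢-≢ {suc zero} {zero}     {suc zero} p q = contradiction refl p

module Edge {P : ℕω → Set} (p : ℕ) (1≤p : 1 ≤ p) (Pp : P (fin p)) where

  edge : Graph 2
  edge = attach single zero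

  edge-tree : IsTree edge
  edge-tree = attach-tree zero single-tree

  A : Str
  A = structure edge-tree (const (fin p))

  A-isFPTree : IsFPTree P A edge
  A-isFPTree = structure-isFPTree edge-tree (const (fin p)) P
    (λ { zero () ; (suc zero) () }) (const Pp)
    λ { zero → 1≤p ; (suc zero) → 1≤p }

  -- The distance of `x` and `y` is irrelevant: on arguments from a two-element set, `D` depends
  -- only on which of them coincide.
  pair-embedding : {S : Str} {E : Graph (size S)} → IsFPTree P S E →
    ∀ {x y} → x ≢ y → K S x ≡ fin p → K S y ≡ fin p → IsEmbedding A S (pair x y)
  pair-embedding {S} S-tree {x} {y} x≢y Kx Ky = injective , D-preserved , K-preserved
    where
    module A = FPTree {P} A-isFPTree
    module S = FPTree {P} S-tree
    f : Fin 2 → Fin (size S)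
    f = pair x y
    injective : ∀ a b → f a ≡ f b → a ≡ b
    injective zero       zero       _ = refl
    injective (suc zero) (suc zero) _ = refl
    injective zero       (suc zero) e = contradiction e x≢y
    injective (suc zero) zero       e = contradiction (sym e) x≢y
    D-preserved : ∀ a b c d → D A a b c d ≡ D S (f a) (f b) (f c) (f d)
    D-preserved a b c d with coincidence a b c d
    ... | inj₁ (refl , refl , a≢c) =
      trans (A.D-distinct a≢c) (sym (S.D-distinct (a≢c ∘ injective a c)))
    ... | inj₂ common = trans (A.D-common common) (sym (S.D-common (image common)))
      where
      image : (a ≡ c ⊎ a ≡ d) ⊎ (b ≡ c ⊎ b ≡ d) →
        (f a ≡ f c ⊎ f a ≡ f d) ⊎ (f b ≡ f c ⊎ f b ≡ f d)
      image (inj₁ (inj₁ e)) = inj₁ (inj₁ (cong f e))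
      image (inj₁ (inj₂ e)) = inj₁ (inj₂ (cong f e))
      image (inj₂ (inj₁ e)) = inj₂ (inj₁ (cong f e))
      image (inj₂ (inj₂ e)) = inj₂ (inj₂ (cong f e))
    K-preserved : ∀ a → fin p ≡ K S (f a)
    K-preserved zero       = sym Kx
    K-preserved (suc zero) = sym Ky

-- Caterpillars

-- Only separation by `v` is demanded of the `y j`, not adjacency; this survives the later
-- attachment of leaves and passes to images under embeddings.
record Tripod {n} (E : Graph n) (K : Fin n → ℕω) (leaf centre : ℕω) : Set where
  field
    v        : Fin n
    y        : Fin 3 → Fin n
    apart    : ∀ {j k} → j ≢ k → ¬ Reach E v (y j) (y k)
    distinct : ∀ {j k} → j ≢ k → y j ≢ y k
    K-v      : K v ≡ centre
    K-y      : ∀ j → K (y j) ≡ leaf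

extend : ∀ {X : Set} → X → (Fin n → X) → Fin (suc n) → X
extend x K zero    = x
extend x K (suc a) = K a

extend-all : ∀ {X : Set} {Q : X → Set} {x : X} {K : Fin n → X} →
  Q x → (∀ a → Q (K a)) → ∀ a → Q (extend x K a)
extend-all Qx QK zero    = Qx
extend-all Qx QK (suc a) = QK a

lift-tripod : ∀ {E : Graph n} {K p q x} u → Tripod E K p q →
  Tripod (attach E u) (extend x K) p q
lift-tripod u T = record
  { v = suc v ; y = suc ∘ y
  ; apart = λ j≢k → apart j≢k ∘ reach-project u
  ; distinct = λ j≢k → distinct j≢k ∘ suc-injective
  ; K-v = K-v ; K-y = K-y }
  where open Tripod T

-- The bound 5 is the degree of an inner centre: three leaves, the spine vertex before it and the
-- one after it.
module Caterpillar {P : ℕω → Set} (p : ℕ → ℕ) (Pp : ∀ i → P (fin (p i)))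
                   (5≤p : ∀ i → 5 ≤ p i) where

  leaf : ℕω
  leaf = fin (p 0)

  -- The spine grows at its end h, whose degree must be able to increase by one.
  record Cat (t : ℕ) : Set where
    field
      {order} : ℕ
      E       : Graph order
      label   : Fin order → ℕω
      E-tree  : IsTree E
      K∈P     : ∀ a → P (label a)
      deg≢2   : ∀ a → degree E a ≢ 2
      deg≤K   : ∀ a → degree E a ≤ω label a
      h       : Fin order
      h-deg≢1 : degree E h ≢ 1
      h-deg<K : suc (degree E h) ≤ω label h
      tripods : ∀ i → i < t → Tripod E label leaf (fin (p i))

  cat-zero : Cat 0
  cat-zero = record
    { E = single ; label = const leaf ; E-tree = single-tree
    ; K∈P = const (Pp 0) ; deg≢2 = λ { zero () } ; deg≤K = λ { zero → z≤n }
    ; h = zero ; h-deg≢1 = λ () ; h-deg<K = ℕ.≤-trans (s≤s z≤n) (5≤p 0)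
    ; tripods = λ _ () }

  cat-suc : ∀ {t} → Cat t → Cat (suc t)
  cat-suc {t} cat = record
    { E = E′ ; label = K′
    ; E-tree = attach-tree c₃ (attach-tree c₂ (attach-tree c₁ (attach-tree h E-tree)))
    ; K∈P = extend-all {Q = P} (Pp 0) (extend-all {Q = P} (Pp 0)
              (extend-all {Q = P} (Pp 0) (extend-all {Q = P} (Pp t) K∈P)))
    ; deg≢2 = deg≢2′ ; deg≤K = deg≤K′
    ; h = suc c₃
    ; h-deg≢1 = λ e → 4≢1 (trans (sym deg-centre) e)
    ; h-deg<K = subst (λ d → suc d ≤ p t) (sym deg-centre) (5≤p t)
    ; tripods = tripods′ }
    where
    open Cat cat
    -- `c₁`, `c₂`, `c₃` and finally `suc c₃` are the same new centre, renumbered as its three leaves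
    -- are attached one by one.
    c₁ : Fin (1 + order)
    c₁ = zero
    c₂ : Fin (2 + order)
    c₂ = suc c₁
    c₃ : Fin (3 + order)
    c₃ = suc c₂
    E₁ : Graph (1 + order)
    E₁ = attach E h
    E₂ : Graph (2 + order)
    E₂ = attach E₁ c₁
    E₃ : Graph (3 + order)
    E₃ = attach E₂ c₂
    E′ : Graph (4 + order)
    E′ = attach E₃ c₃
    K′ : Fin (4 + order) → ℕω
    K′ = extend leaf (extend leaf (extend leaf (extend (fin (p t)) label)))

    4≢1 : 4 ≢ 1
    4≢1 ()

    deg-leaf₁ : degree E′ (suc (suc zero)) ≡ 1
    deg-leaf₁ = trans (degree-attach E₃ c₃ (suc zero))
      (trans (degree-attach E₂ c₂ zero) (degree-leaf E₁ c₁))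

    deg-leaf₂ : degree E′ (suc zero) ≡ 1
    deg-leaf₂ = trans (degree-attach E₃ c₃ zero) (degree-leaf E₂ c₂)

    deg-leaf₃ : degree E′ zero ≡ 1
    deg-leaf₃ = degree-leaf E₃ c₃

    deg-centre : degree E′ (suc c₃) ≡ 4
    deg-centre = trans (degree-attach E₃ c₃ c₃) (cong suc
      (trans (degree-attach E₂ c₂ c₂) (cong suc
        (trans (degree-attach E₁ c₁ c₁) (cong suc (degree-leaf E h))))))

    deg-old : ∀ a → degree E′ (suc (suc (suc (suc a)))) ≡
      (if does (h ≟ a) then 1 else 0) + degree E a
    deg-old a = trans (degree-attach E₃ c₃ (suc (suc (suc a))))
      (trans (degree-attach E₂ c₂ (suc (suc a)))
        (trans (degree-attach E₁ c₁ (suc a)) (degree-attach E h a)))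

    deg≢2′ : ∀ a → degree E′ a ≢ 2
    deg≢2′ zero e with () ← trans (sym deg-leaf₃) e
    deg≢2′ (suc zero) e with () ← trans (sym deg-leaf₂) e
    deg≢2′ (suc (suc zero)) e with () ← trans (sym deg-leaf₁) e
    deg≢2′ (suc (suc (suc zero))) e with () ← trans (sym deg-centre) e
    deg≢2′ (suc (suc (suc (suc a)))) e with h ≟ a | trans (sym (deg-old a)) e
    -- Among old vertices only `h` gains an edge, and it would reach degree 2 only from degree 1.
    ... | yes refl | e′ = h-deg≢1 (ℕ.suc-injective e′)
    ... | no _     | e′ = deg≢2 a e′

    1≤p : ∀ i → 1 ≤ p i
    1≤p i = ℕ.≤-trans (s≤s z≤n) (5≤p i)

    deg≤K′ : ∀ a → degree E′ a ≤ω K′ a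
    deg≤K′ zero = subst (_≤ p 0) (sym deg-leaf₃) (1≤p 0)
    deg≤K′ (suc zero) = subst (_≤ p 0) (sym deg-leaf₂) (1≤p 0)
    deg≤K′ (suc (suc zero)) = subst (_≤ p 0) (sym deg-leaf₁) (1≤p 0)
    deg≤K′ (suc (suc (suc zero))) =
      subst (_≤ p t) (sym deg-centre) (ℕ.≤-trans (ℕ.n≤1+n 4) (5≤p t))
    deg≤K′ (suc (suc (suc (suc a)))) =
      subst (_≤ω label a) (sym (deg-old a)) old
      where
      old : ((if does (h ≟ a) then 1 else 0) + degree E a) ≤ω label a
      old with h ≟ a
      ... | yes refl = h-deg<K
      ... | no _     = deg≤K a

    E′-sym : Symmetric E′
    E′-sym = attach-sym c₃ (attach-sym c₂ (attach-sym c₁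
      (attach-sym h (Tree.E-sym E-tree))))

    y′ : Fin 3 → Fin (4 + order)
    -- The three leaves were attached last, so their indices are 0, 1 and 2.
    y′ j = j ↑ˡ suc order

    apart′ : ∀ {j k} → j ≢ k → ¬ Reach E′ (suc c₃) (y′ j) (y′ k)
    apart′ {zero}           {zero}           j≢k _ = j≢k refl
    apart′ {suc zero}       {suc zero}       j≢k _ = j≢k refl
    apart′ {suc (suc zero)} {suc (suc zero)} j≢k _ = j≢k refl
    -- Leaf 0 is cut off in `E′` itself; to separate leaves 1 and 2, leaf 0 is first projected away.
    apart′ {zero}           {suc zero}       _ = leaf-separated c₃
    apart′ {zero}           {suc (suc zero)} _ = leaf-separated c₃
    apart′ {suc zero}       {suc (suc zero)} _ = leaf-separated c₂ ∘ reach-project c₃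
    apart′ {suc zero}       {zero}           _ = leaf-separated c₃ ∘ Reach-sym E′-sym
    apart′ {suc (suc zero)} {zero}           _ = leaf-separated c₃ ∘ Reach-sym E′-sym
    apart′ {suc (suc zero)} {suc zero}       _ =
      leaf-separated c₂ ∘ reach-project c₃ ∘ Reach-sym E′-sym

    tripods′ : ∀ i → i < suc t → Tripod E′ K′ leaf (fin (p i))
    tripods′ i i<1+t with i ℕ.≟ t
    ... | yes refl = record
      { v = suc c₃ ; y = y′ ; apart = apart′
      ; distinct = λ j≢k → j≢k ∘ ↑ˡ-injective (suc order) _ _
      ; K-v = refl
      ; K-y = λ { zero → refl ; (suc zero) → refl ; (suc (suc zero)) → refl } }
    ... | no i≢t = lift-tripod c₃ (lift-tripod c₂ (lift-tripod c₁
      (lift-tripod h (tripods i (ℕ.≤∧≢⇒< (ℕ.≤-pred i<1+t) i≢t)))))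

  cat : ∀ t → Cat t
  cat zero    = cat-zero
  cat (suc t) = cat-suc (cat t)

-- The colouring

fin-injective : ∀ {p q} → fin p ≡ fin q → p ≡ q
fin-injective refl = refl

_≟fin_ : (x : ℕω) (q : ℕ) → Dec (x ≡ fin q)
fin p ≟fin q = map′ (cong fin) fin-injective (p ℕ.≟ q)
ω     ≟fin q = no λ ()

step-mono : {p : ℕ → ℕ} → (∀ i → p i < p (suc i)) → ∀ {i j} → i < j → p i < p j
step-mono p< {i} {suc j} (s≤s i≤j) with ℕ.m≤n⇒m<n∨m≡n i≤j
... | inj₁ i<j  = ℕ.<-trans (step-mono p< i<j) (p< j)
... | inj₂ refl = p< j

step-mono⇒injective : {p : ℕ → ℕ} → (∀ i → p i < p (suc i)) → ∀ {i j} → p i ≡ p j → i ≡ j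
step-mono⇒injective p< {i} {j} e with ℕ.<-cmp i j
... | tri< i<j _ _ = contradiction e (ℕ.<⇒≢ (step-mono p< i<j))
... | tri≈ _ i≡j _ = i≡j
... | tri> _ _ j<i = contradiction (sym e) (ℕ.<⇒≢ (step-mono p< j<i))

module MedianColouring {P : ℕω → Set} (p : ℕ → ℕ) {C : Str} {E : Graph (size C)}
    (C-tree : IsFPTree P C E) (r : Fin (size C)) (t : ℕ) where

  open FPTree {P} C-tree

  HasMedianLabel : Fin (size C) → Fin (size C) → Fin (suc t) → Set
  HasMedianLabel x y i = ∃ λ m → Median r x y m × K C m ≡ fin (p (toℕ i))

  hasMedianLabel? : ∀ x y → Dec (∃ (HasMedianLabel x y))
  hasMedianLabel? x y = any? λ i → any? λ m → median? r x y m ×-dec (K C m ≟fin p (toℕ i))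

  colour : Fin (size C) → Fin (size C) → Fin (suc t)
  colour x y with hasMedianLabel? x y
  ... | yes (i , _) = i
  -- Default colour for pairs whose median has none of the labels `p 0` to `p t`; pairs coming from
  -- a tripod never fall here.
  ... | no _        = zero

  -- The search may find another witness, but the median is unique and distinct indices have
  -- distinct labels, so the colour agrees.
  colour-median : (∀ {i j} → p i ≡ p j → i ≡ j) →
    ∀ {x y i} → HasMedianLabel x y i → colour x y ≡ i
  colour-median p-inj {x} {y} {i} (m , med , Km) with hasMedianLabel? x y
  ... | no none = contradiction (i , m , med , Km) none
  ... | yes (j , m′ , med′ , Km′) with median-unique med med′
  ...   | refl = toℕ-injective (p-inj (fin-injective (trans (sym Km′) Km)))

-- Infinite Ramsey degree of the edge

theorem4p2 : (P : ℕω → Set) →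
    (∀ n → P (fin n) → 3 ≤ n) →
    (∀ m → ∃ λ n → m ≤ n × P (fin n)) →
    Σ Str λ A → 𝓕 P A × InfiniteRamseyDegree (𝓕 P) A
theorem4p2 P _ large = A , (edge , A-isFPTree) , ramsey
  where
  p : ℕ → ℕ
  -- A strictly increasing sequence of finite labels from `P`. `p 0` labels both vertices of `A` and
  -- the tripod leaves, `p i` the centre for colour `i`.
  p zero    = proj₁ (large 5)
  p (suc i) = proj₁ (large (suc (p i)))

  Pp : ∀ i → P (fin (p i))
  Pp zero    = proj₂ (proj₂ (large 5))
  Pp (suc i) = proj₂ (proj₂ (large (suc (p i))))

  p< : ∀ i → p i < p (suc i)
  p< i = proj₁ (proj₂ (large (suc (p i))))

  5≤p : ∀ i → 5 ≤ p i
  5≤p zero    = proj₁ (proj₂ (large 5))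
  5≤p (suc i) = ℕ.≤-trans (5≤p i) (ℕ.<⇒≤ (p< i))

  open Edge {P} (p 0) (ℕ.≤-trans (s≤s z≤n) (5≤p 0)) (Pp 0)
  open Caterpillar {P} p Pp 5≤p using (cat; module Cat)

  ramsey : InfiniteRamseyDegree (𝓕 P) A
  ramsey (suc t) _ = B , (Cat.E B₀ , B-isFPTree) , tripod-pair zero {zero} {suc zero} (λ ()) ,
    λ { C (E , C-tree) B≤C → coloured C E C-tree B≤C }
    where
    B₀ = cat (suc t)
    B : Str
    B = structure (Cat.E-tree B₀) (Cat.label B₀)

    B-isFPTree : IsFPTree P B (Cat.E B₀)
    B-isFPTree = structure-isFPTree (Cat.E-tree B₀) (Cat.label B₀) P
      (Cat.deg≢2 B₀) (Cat.K∈P B₀) (Cat.deg≤K B₀)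

    module T (i : Fin (suc t)) = Tripod (Cat.tripods B₀ (toℕ i) (toℕ<n i))

    tripod-pair : ∀ i {j k} → j ≢ k → Emb A B
    tripod-pair i {j} {k} j≢k = pair (T.y i j) (T.y i k) ,
      pair-embedding B-isFPTree (T.distinct i j≢k) (T.K-y i j) (T.K-y i k)

    coloured : ∀ C E → IsFPTree P C E → B ≤S C →
      Σ (Emb A C → Fin (suc t)) λ c₀ →
        ∀ (g : Emb B C) (i : Fin (suc t)) → ∃ λ (f : Emb A B) → c₀ (compE A B C g f) ≡ i
    coloured C E C-tree _ = c₀ , all-colours
      where
      r : Fin (size C)
      -- The root depends on `C` alone, since the colouring is fixed before the copy `g` of `B` is
      -- given.
      r = fromℕ< (proj₁ (proj₁ C-tree))
      module B = FPTree {P} B-isFPTree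
      module C = FPTree {P} C-tree
      open MedianColouring {P} p C-tree r t

      c₀ : Emb A C → Fin (suc t)
      c₀ (f , _) = colour (f zero) (f (suc zero))

      all-colours : ∀ (g : Emb B C) i → ∃ λ (f : Emb A B) → c₀ (compE A B C g f) ≡ i
      all-colours (g , _ , gD , gK) i with C.tripod-median {g (T.v i)} {g ∘ T.y i} apart-g r
        where
        apart-g : ∀ {j k} → j ≢ k → ¬ Reach E (g (T.v i)) (g (T.y i j)) (g (T.y i k))
        -- A connection in `C` avoiding the image of the centre is a true instance of `D`, which `g`
        -- reflects back to `B`.
        apart-g j≢k s = T.apart i j≢k
          (B.D≡true⇒reach (trans (gD _ _ _ _) (C.reach⇒D≡true s)))
      -- Which two leaves are used depends on `g`, but their median with `r` is always the image of
      -- the centre, and `g` keeps its label `p i`.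
      ... | j , k , j≢k , med = tripod-pair i j≢k ,
        colour-median (step-mono⇒injective p<)
          (g (T.v i) , med , trans (sym (gK (T.v i))) (T.K-v i))
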